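{- For all integers $k\ge 0$ and $n \ge k+3$ we have $\mathrm{av}_n^k(1324,1243)=p(k)$, where $p(k)$ is the number of integer partitions of $k$.
   Context: $\mathrm{av}_n^k(B)$ is the number of permutations in $S_n$ with exactly $k$ inversions (pairs $i<j$ with $\pi_i>\pi_j$) that avoid every pattern in $B$; a permutation avoids a pattern $q$ if it has no subsequence order-isomorphic to $q$. -}

module Defs where

open import Data.Fin.Base as Fin using (Fin; punchIn)
open import Data.Fin.Patterns using (0F; 1F; 2F; 3F)
open import Data.Fin.Permutation
  using (Permutation′; _⟨$⟩ʳ_; _≈_; id; insert; remove; transpose; insert-remove; insert-punchIn)
import Data.Fin.Properties as Fin
open import Data.List.Base
  using (List; []; _∷_; length; filter; upTo; allFin; cartesianProduct; cartesianProductWith)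
open import Data.List.Membership.Propositional using (_∈_)
open import Data.List.Membership.Propositional.Properties
  using (∈-allFin; ∈-upTo⁺; ∈-cartesianProductWith⁺; ∈-cartesianProductWith⁻; ∈-filter⁺; ∈-filter⁻)
import Data.List.Membership.Setoid as SetoidMembership
import Data.List.Membership.Setoid.Properties as SetoidMembership
open import Data.List.Properties using (∷-injective)
open import Data.List.Relation.Unary.All as All using (All; []; _∷_)
open import Data.List.Relation.Unary.AllPairs using ([]; _∷_)
open import Data.List.Relation.Unary.Any using (here; there)
open import Data.List.Relation.Unary.Linked as Linked using (Linked)
open import Data.List.Relation.Unary.Unique.Propositional using (Unique)
import Data.List.Relation.Unary.Unique.Propositional.Properties as Unique
import Data.List.Relation.Unary.Unique.Setoid as SetoidUnique
import Data.List.Relation.Unary.Unique.Setoid.Properties as SetoidUnique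
open import Data.Nat.Base as ℕ using (ℕ; zero; suc; _≤_; _<_; _≥_; z≤n; s≤s)
open import Data.Nat.ListAction using (sum)
import Data.Nat.Properties as ℕ
open import Data.Product.Base using (_×_; _,_; ∃; proj₁; proj₂)
open import Data.Vec.Base as Vec using (Vec; []; _∷_; lookup)
open import Function.Base using (_∘_)
open import Level using (0ℓ)
open import Relation.Binary.Bundles using (Setoid)
open import Relation.Binary.PropositionalEquality
  using (_≡_; refl; sym; trans; cong; subst; setoid)
open import Relation.Nullary using (¬_; Dec)
open import Relation.Nullary.Decidable using (map′; ¬?; _×-dec_; _→-dec_)
open import Relation.Unary using (Pred; Decidable)

IsInversion : ∀ {n} → Permutation′ n → Pred (Fin n × Fin n) 0ℓ
IsInversion π (i , j) = i Fin.< j × π ⟨$⟩ʳ i Fin.> π ⟨$⟩ʳ j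

isInversion? : ∀ {n} (π : Permutation′ n) → Decidable (IsInversion π)
isInversion? π (i , j) = i Fin.<? j ×-dec π ⟨$⟩ʳ j Fin.<? π ⟨$⟩ʳ i

inv : ∀ {n} → Permutation′ n → ℕ
inv {n} π = length (filter (isInversion? π) (cartesianProduct (allFin n) (allFin n)))

Pattern : Set
Pattern = ∃ λ m → Permutation′ m

-- The pattern 1324 exchanges the (0-based) positions 1 and 2 of the
-- identity of S₄, and 1243 exchanges 2 and 3.
q₁₃₂₄ q₁₂₄₃ : Pattern
q₁₃₂₄ = 4 , transpose 1F 2F
q₁₂₄₃ = 4 , transpose 2F 3F

oneLine : (q : Pattern) → Vec ℕ (proj₁ q)
oneLine (_ , π) = Vec.tabulate λ i → suc (Fin.toℕ (π ⟨$⟩ʳ i))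

_ : oneLine q₁₃₂₄ ≡ 1 ∷ 3 ∷ 2 ∷ 4 ∷ []
_ = refl

_ : oneLine q₁₂₄₃ ≡ 1 ∷ 2 ∷ 4 ∷ 3 ∷ []
_ = refl

-- The entries of is are the positions of the subsequence, left to right.
Occurrence : ∀ {m n} → Permutation′ m → Permutation′ n → Vec (Fin n) m → Set
Occurrence q π is =
  (∀ a b → a Fin.< b → lookup is a Fin.< lookup is b) ×
  (∀ a b → (q ⟨$⟩ʳ a Fin.< q ⟨$⟩ʳ b → π ⟨$⟩ʳ lookup is a Fin.< π ⟨$⟩ʳ lookup is b) ×
           (π ⟨$⟩ʳ lookup is a Fin.< π ⟨$⟩ʳ lookup is b → q ⟨$⟩ʳ a Fin.< q ⟨$⟩ʳ b))

Contains : ∀ {n} → Permutation′ n → Pattern → Set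
Contains π (m , q) = ∃ (Occurrence q π)

Avoids : ∀ {n} → List Pattern → Pred (Permutation′ n) 0ℓ
Avoids B π = All (λ q → ¬ Contains π q) B

occurrence? : ∀ {m n} (q : Permutation′ m) (π : Permutation′ n) → Decidable (Occurrence q π)
occurrence? q π is =
  (Fin.all? λ a → Fin.all? λ b → a Fin.<? b →-dec lookup is a Fin.<? lookup is b) ×-dec
  (Fin.all? λ a → Fin.all? λ b →
    let q<? = q ⟨$⟩ʳ a Fin.<? q ⟨$⟩ʳ b
        π<? = π ⟨$⟩ʳ lookup is a Fin.<? π ⟨$⟩ʳ lookup is b
    in (q<? →-dec π<?) ×-dec (π<? →-dec q<?))

anyVec? : ∀ {n} m {P : Pred (Vec (Fin n) m) 0ℓ} → Decidable P → Dec (∃ P)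
anyVec? zero    P? = map′ ([] ,_) (λ { ([] , p) → p }) (P? [])
anyVec? (suc m) P? = map′
  (λ (i , is , p) → i ∷ is , p)
  (λ { (i ∷ is , p) → i , is , p })
  (Fin.any? λ i → anyVec? m (P? ∘ (i ∷_)))

contains? : ∀ {n} (π : Permutation′ n) → Decidable (Contains π)
contains? π (m , q) = anyVec? m (occurrence? q π)

avoids? : ∀ {n} (B : List Pattern) → Decidable (Avoids {n} B)
avoids? B π = All.all? (λ q → ¬? (contains? π q)) B

-- Permutation′ n carries inverse maps and proofs, so permutations are
-- identified when they agree pointwise.
≈-setoid : ℕ → Setoid 0ℓ 0ℓ
≈-setoid n = record
  { Carrier       = Permutation′ n
  ; _≈_           = _≈_
  ; isEquivalence = record
    { refl  = λ _ → refl
    ; sym   = λ e i → sym (e i)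
    ; trans = λ e f i → trans (e i) (f i)
    }
  }

-- The first value j is chosen freely, and the remaining n values are
-- arranged, relative to each other, by a permutation of Fin n.
permutations : ∀ n → List (Permutation′ n)
permutations zero    = id ∷ []
permutations (suc n) = cartesianProductWith (insert 0F) (allFin (suc n)) (permutations n)

insert-cong : ∀ {n} {j k : Fin (suc n)} {π ρ : Permutation′ n} →
              j ≡ k → π ≈ ρ → insert 0F j π ≈ insert 0F k ρ
insert-cong {j = j} {π = π} {ρ} refl e 0F          = refl
insert-cong {j = j} {π = π} {ρ} refl e (Fin.suc i) =
  trans (insert-punchIn 0F j π i)
    (trans (cong (punchIn j) (e i)) (sym (insert-punchIn 0F j ρ i)))

insert-injective : ∀ {n} {j k : Fin (suc n)} {π ρ : Permutation′ n} →
                   insert 0F j π ≈ insert 0F k ρ → j ≡ k × π ≈ ρ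
insert-injective {j = j} {k} {π} {ρ} e with e 0F
... | refl = refl , λ i → Fin.punchIn-injective j _ _
  (trans (sym (insert-punchIn 0F j π i)) (trans (e (Fin.suc i)) (insert-punchIn 0F j ρ i)))

permutations-complete : ∀ {n} (π : Permutation′ n) →
                        SetoidMembership._∈_ (≈-setoid n) π (permutations n)
permutations-complete {zero}  π = here λ ()
permutations-complete {suc n} π =
  SetoidMembership.∈-resp-≈ (≈-setoid (suc n))
    {x = insert 0F (π ⟨$⟩ʳ 0F) (remove 0F π)} {y = π} (insert-remove 0F π)
    (SetoidMembership.∈-cartesianProductWith⁺
      (setoid (Fin (suc n))) (≈-setoid n) (≈-setoid (suc n))
      (λ {j} {k} {π} {ρ} → insert-cong {π = π} {ρ})
      (∈-allFin (π ⟨$⟩ʳ 0F)) (permutations-complete (remove 0F π)))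

permutations-unique : ∀ n → SetoidUnique.Unique (≈-setoid n) (permutations n)
permutations-unique zero    = [] ∷ []
permutations-unique (suc n) = SetoidUnique.cartesianProductWith⁺
  (setoid (Fin (suc n))) (≈-setoid n) (≈-setoid (suc n)) (insert 0F)
  (λ {_} {_} {π} {ρ} → insert-injective {π = π} {ρ})
  (Unique.allFin⁺ (suc n)) (permutations-unique n)

av : (n k : ℕ) → List Pattern → ℕ
av n k B = length (filter (λ π → inv π ℕ.≟ k ×-dec avoids? B π) (permutations n))

IsPartition : ℕ → Pred (List ℕ) 0ℓ
IsPartition k xs = All (0 <_) xs × Linked _≥_ xs × sum xs ≡ k

isPartition? : ∀ k → Decidable (IsPartition k)
isPartition? k xs =
  All.all? (0 ℕ.<?_) xs ×-dec Linked.linked? ℕ._≥?_ xs ×-dec sum xs ℕ.≟ k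

boundedLists : (ℓ m : ℕ) → List (List ℕ)
boundedLists zero    m = [] ∷ []
boundedLists (suc ℓ) m = [] ∷ cartesianProductWith _∷_ (upTo (suc m)) (boundedLists ℓ m)

-- A partition of k has at most k parts, each of them at most k.
partitions : ℕ → List (List ℕ)
partitions k = filter (isPartition? k) (boundedLists k k)

p : ℕ → ℕ
p k = length (partitions k)

boundedLists-complete : ∀ {ℓ m} xs → length xs ≤ ℓ → All (_≤ m) xs → xs ∈ boundedLists ℓ m
boundedLists-complete {zero}  []       _         _          = here refl
boundedLists-complete {suc ℓ} []       _         _          = here refl
boundedLists-complete {suc ℓ} (x ∷ xs) (s≤s len) (x≤ ∷ xs≤) =
  there (∈-cartesianProductWith⁺ _∷_ (∈-upTo⁺ (s≤s x≤)) (boundedLists-complete xs len xs≤))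

boundedLists-unique : ∀ ℓ m → Unique (boundedLists ℓ m)
boundedLists-unique zero    m = [] ∷ []
boundedLists-unique (suc ℓ) m =
  All.tabulate (λ {xs} xs∈ []≡xs → []∉ (subst (_∈ _) (sym []≡xs) xs∈)) ∷
  Unique.cartesianProductWith⁺ _∷_ ∷-injective (Unique.upTo⁺ (suc m)) (boundedLists-unique ℓ m)
  where
  []∉ : ¬ ([] ∈ cartesianProductWith _∷_ (upTo (suc m)) (boundedLists ℓ m))
  []∉ []∈ with ∈-cartesianProductWith⁻ _∷_ (upTo (suc m)) (boundedLists ℓ m) []∈
  ... | _ , _ , _ , _ , ()

length≤sum : ∀ {xs} → All (0 <_) xs → length xs ≤ sum xs
length≤sum []         = z≤n
length≤sum (0<x ∷ xs) = ℕ.+-mono-≤ 0<x (length≤sum xs)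

all≤sum : ∀ xs → All (_≤ sum xs) xs
all≤sum []       = []
all≤sum (x ∷ xs) =
  ℕ.m≤m+n x (sum xs) ∷ All.map (λ y≤ → ℕ.≤-trans y≤ (ℕ.m≤n+m (sum xs) x)) (all≤sum xs)

partitions-sound : ∀ {k xs} → xs ∈ partitions k → IsPartition k xs
partitions-sound {k} = proj₂ ∘ ∈-filter⁻ (isPartition? k) {xs = boundedLists k k}

partitions-complete : ∀ {k xs} → IsPartition k xs → xs ∈ partitions k
partitions-complete {_} {xs} part@(pos , _ , refl) =
  ∈-filter⁺ (isPartition? _) (boundedLists-complete xs (length≤sum pos) (all≤sum xs)) part

partitions-unique : ∀ k → Unique (partitions k)
partitions-unique k = Unique.filter⁺ (isPartition? k) (boundedLists-unique k k)

{-# OPTIONS --safe #-}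
-- A permutation with k inversions and length n ≥ k + 3 has at least three
-- components as a direct sum, so that an occurrence of 132 always
-- forces one of 1324 or 1243: under the hypothesis, avoiding both is the
-- same as avoiding 132.  A permutation avoids 132 exactly when its Lehmer code
-- is weakly decreasing, and the entries of the code add up to the number of
-- inversions; without its zeros, the code is thus a partition of k, and every
-- partition of k fits because n > k.
module Submission where

open import Defs
open import Data.Empty using (⊥; ⊥-elim)
open import Data.Fin.Base as Fin using (Fin; zero; suc; toℕ; fromℕ; fromℕ<; punchIn)
open import Data.Fin.Patterns using (0F; 1F; 2F; 3F)
open import Data.Fin.Permutation
  using (Permutation′; _⟨$⟩ʳ_; _⟨$⟩ˡ_; _≈_; id; insert; remove; inverseˡ; inverseʳ;
         insert-punchIn; punchIn-permute)
import Data.Fin.Properties as Fin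
open import Data.List.Base
  using (List; []; _∷_; _++_; map; length; filter; tabulate; allFin; cartesianProduct)
open import Data.List.Membership.Propositional using (_∈_; lose; find)
open import Data.List.Membership.Propositional.Properties using (∈-allFin; ∈-filter⁺; ∈-filter⁻)
open import Data.List.Properties
  using (filter-++; filter-≐; filter-reject; length-++; length-removeAt′; length-tabulate; map-tabulate; map-cong)
open import Data.List.Relation.Unary.All as All using (All; []; _∷_)
open import Data.List.Relation.Unary.AllPairs using (AllPairs; []; _∷_)
open import Data.List.Relation.Unary.Any as Any using (Any; here; there; _─_)
open import Data.List.Relation.Unary.Linked using (Linked; []; [-]; _∷_)
import Data.List.Relation.Unary.Unique.Propositional.Properties as Unique
import Data.List.Relation.Unary.Unique.Setoid.Properties as SetoidUnique
open import Data.Nat.Base as ℕ using (ℕ; _+_; _≤_; _<_; _≥_; z≤n; s≤s; z<s)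
open import Data.Nat.ListAction using (sum)
import Data.Nat.Properties as ℕ
open import Data.Product.Base using (_×_; _,_; ∃; proj₁; proj₂)
open import Data.Vec.Base using (Vec; []; _∷_; lookup)
open import Function.Base using (_∘_; flip)
open import Level using (0ℓ)
open import Relation.Binary.Core using (Rel; REL)
open import Relation.Binary.Definitions using (tri<; tri≈; tri>)
open import Relation.Binary.PropositionalEquality
  using (_≡_; _≢_; refl; sym; trans; cong; cong₂; subst; subst₂; module ≡-Reasoning)
open import Relation.Nullary using (¬_; yes; no)
open import Relation.Nullary.Decidable using (_×-dec_)
open import Relation.Unary using (Pred; Decidable)

-- Comparing the lengths of lists

Any-─ : ∀ {B : Set} {P Q : Pred B 0ℓ} {ys} (p : Any P ys) → Any Q ys →
        (∀ {y} → P y → Q y → ⊥) → Any Q (ys ─ p)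
Any-─ (here py)  (here qy)  disjoint = ⊥-elim (disjoint py qy)
Any-─ (here _)   (there q)  _        = q
Any-─ (there _)  (here qy)  _        = here qy
Any-─ (there p)  (there q)  disjoint = there (Any-─ p q disjoint)

module _ {A B : Set} {_#_ : Rel A 0ℓ} {R : REL A B 0ℓ} where

  -- Pigeonhole by deletion: each match is deleted from `ys` once it is used, and injectivity of `R`
  -- keeps the matches of the later entries away from it.
  length-≤ : (∀ {x x′ y} → x # x′ → R x y → R x′ y → ⊥) →
             ∀ {xs ys} → AllPairs _#_ xs → (∀ {x} → x ∈ xs → Any (R x) ys) →
             length xs ≤ length ys
  length-≤ inj []        _   = z≤n
  length-≤ inj {ys = ys} (x# ∷ u) tot = subst (_ ≤_) (sym (length-removeAt′ ys (Any.index match)))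
    (s≤s (length-≤ inj u λ x′∈ → Any-─ match (tot (there x′∈)) (inj (All.lookup x# x′∈))))
    where match = tot (here refl)

-- A relation stands in for a bijection because permutations are compared only up to `≈`; the two
-- lists may use different notions of distinctness.
length-≡ : ∀ {A B : Set} {_#_ : Rel A 0ℓ} {_#′_ : Rel B 0ℓ} (R : REL A B 0ℓ) {xs ys} →
           (∀ {x x′ y} → x # x′ → R x y → R x′ y → ⊥) →
           (∀ {x y y′} → y #′ y′ → R x y → R x y′ → ⊥) →
           AllPairs _#_ xs → AllPairs _#′_ ys →
           (∀ {x} → x ∈ xs → Any (R x) ys) →
           (∀ {y} → y ∈ ys → Any (flip R y) xs) →
           length xs ≡ length ys
length-≡ R injˡ injʳ u v totˡ totʳ = ℕ.≤-antisym (length-≤ injˡ u totˡ) (length-≤ injʳ v totʳ)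

length-filter-map : ∀ {A B : Set} {P : Pred B 0ℓ} (P? : Decidable P) (f : A → B) xs →
                    length (filter P? (map f xs)) ≡ length (filter (P? ∘ f) xs)
length-filter-map P? f []       = refl
length-filter-map P? f (x ∷ xs) with P? (f x)
... | yes _ = cong ℕ.suc (length-filter-map P? f xs)
... | no  _ = length-filter-map P? f xs

length-filter-× : ∀ {A B : Set} {P : Pred (A × B) 0ℓ} (P? : Decidable P) xs ys →
                  length (filter P? (cartesianProduct xs ys)) ≡
                  sum (map (λ x → length (filter (P? ∘ (x ,_)) ys)) xs)
length-filter-× P? []       ys = refl
length-filter-× P? (x ∷ xs) ys = begin
  length (filter P? (map (x ,_) ys ++ rest))
    ≡⟨ cong length (filter-++ P? (map (x ,_) ys) rest) ⟩
  length (filter P? (map (x ,_) ys) ++ filter P? rest)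
    ≡⟨ length-++ (filter P? (map (x ,_) ys)) ⟩
  length (filter P? (map (x ,_) ys)) + length (filter P? rest)
    ≡⟨ cong₂ _+_ (length-filter-map P? (x ,_) ys) (length-filter-× P? xs ys) ⟩
  _ ∎
  where
  open ≡-Reasoning
  rest = cartesianProduct xs ys

-- Removing the first entry of a permutation

injective : ∀ {n} (π : Permutation′ n) {i j} → π ⟨$⟩ʳ i ≡ π ⟨$⟩ʳ j → i ≡ j
injective π e = trans (sym (inverseˡ π)) (trans (cong (π ⟨$⟩ˡ_) e) (inverseˡ π))

≤∧≢⇒< : ∀ {n} {i j : Fin n} → i Fin.≤ j → i ≢ j → i Fin.< j
≤∧≢⇒< i≤j i≢j = ℕ.≤∧≢⇒< i≤j (i≢j ∘ Fin.toℕ-injective)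

punchIn-mono-< : ∀ {n} i {j k : Fin n} → j Fin.< k → punchIn i j Fin.< punchIn i k
punchIn-mono-< i j<k = ℕ.≰⇒> λ k≤j → ℕ.<⇒≱ j<k (Fin.punchIn-cancel-≤ i _ _ k≤j)

punchIn-cancel-< : ∀ {n} i {j k : Fin n} → punchIn i j Fin.< punchIn i k → j Fin.< k
punchIn-cancel-< i j<k = ℕ.≰⇒> λ k≤j → ℕ.<⇒≱ j<k (Fin.punchIn-mono-≤ i _ _ k≤j)

≤⇒<punchIn : ∀ {n} (i : Fin (ℕ.suc n)) {j : Fin n} → toℕ i ≤ toℕ j → i Fin.< punchIn i j
≤⇒<punchIn zero            _         = z<s
≤⇒<punchIn (suc i) {suc j} (s≤s i≤j) = s≤s (≤⇒<punchIn i i≤j)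

<punchIn⇒≤ : ∀ {n} (i : Fin (ℕ.suc n)) {j : Fin n} → i Fin.< punchIn i j → toℕ i ≤ toℕ j
<punchIn⇒≤ zero            _         = z≤n
<punchIn⇒≤ (suc i) {suc j} (s≤s i<j) = s≤s (<punchIn⇒≤ i i<j)

-- One step of the recursion on length, kept as a relation so that the same lemmas serve `remove`,
-- which reads a code, and `insert`, which builds one.
Extends : ∀ {n} → Permutation′ (ℕ.suc n) → Permutation′ n → Set
Extends π ρ = ∀ i → π ⟨$⟩ʳ suc i ≡ punchIn (π ⟨$⟩ʳ 0F) (ρ ⟨$⟩ʳ i)

extends-remove : ∀ {n} (π : Permutation′ (ℕ.suc n)) → Extends π (remove 0F π)
extends-remove π = punchIn-permute π 0F

extends-insert : ∀ {n} j (ρ : Permutation′ n) → Extends (insert 0F j ρ) ρ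
extends-insert j ρ = insert-punchIn 0F j ρ

module _ {n} {π : Permutation′ (ℕ.suc n)} {ρ : Permutation′ n} (ext : Extends π ρ) where

  ext-mono-< : ∀ {i j} → ρ ⟨$⟩ʳ i Fin.< ρ ⟨$⟩ʳ j → π ⟨$⟩ʳ suc i Fin.< π ⟨$⟩ʳ suc j
  ext-mono-< {i} {j} = subst₂ Fin._<_ (sym (ext i)) (sym (ext j)) ∘ punchIn-mono-< (π ⟨$⟩ʳ 0F)

  ext-cancel-< : ∀ {i j} → π ⟨$⟩ʳ suc i Fin.< π ⟨$⟩ʳ suc j → ρ ⟨$⟩ʳ i Fin.< ρ ⟨$⟩ʳ j
  ext-cancel-< {i} {j} = punchIn-cancel-< (π ⟨$⟩ʳ 0F) ∘ subst₂ Fin._<_ (ext i) (ext j)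

  ≤⇒head< : ∀ {i} → toℕ (π ⟨$⟩ʳ 0F) ≤ toℕ (ρ ⟨$⟩ʳ i) → π ⟨$⟩ʳ 0F Fin.< π ⟨$⟩ʳ suc i
  ≤⇒head< {i} = subst (π ⟨$⟩ʳ 0F Fin.<_) (sym (ext i)) ∘ ≤⇒<punchIn (π ⟨$⟩ʳ 0F)

  head<⇒≤ : ∀ {i} → π ⟨$⟩ʳ 0F Fin.< π ⟨$⟩ʳ suc i → toℕ (π ⟨$⟩ʳ 0F) ≤ toℕ (ρ ⟨$⟩ʳ i)
  head<⇒≤ {i} = <punchIn⇒≤ (π ⟨$⟩ʳ 0F) ∘ subst (π ⟨$⟩ʳ 0F Fin.<_) (ext i)

-- Inversions

row : ∀ {n} → Permutation′ n → Fin n → ℕ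
row {n} π i = length (filter (λ j → isInversion? π (i , j)) (allFin n))

-- Every value below the first entry occurs to its right, so the positions counted are matched with
-- these values.
row-zero : ∀ {n} (π : Permutation′ (ℕ.suc n)) → row π 0F ≡ toℕ (π ⟨$⟩ʳ 0F)
row-zero {n} π = trans
  (length-≡ (λ j v → toℕ (π ⟨$⟩ʳ j) ≡ toℕ v)
    (λ j≢ e e′ → j≢ (injective π (Fin.toℕ-injective (trans e (sym e′)))))
    (λ v≢ e e′ → v≢ (Fin.toℕ-injective (trans (sym e) e′)))
    (Unique.filter⁺ (λ j → isInversion? π (0F , j)) (Unique.allFin⁺ (ℕ.suc n)))
    (Unique.allFin⁺ _)
    (λ j∈ → let _ , _ , πj<π0 = ∈-filter⁻ (λ j → isInversion? π (0F , j)) {xs = allFin _} j∈ in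
            lose (∈-allFin (fromℕ< πj<π0)) (sym (Fin.toℕ-fromℕ< πj<π0)))
    (λ {v} _ → lose (∈-filter⁺ (λ j → isInversion? π (0F , j)) (∈-allFin (position v))
                      (0<position v , subst (_< toℕ (π ⟨$⟩ʳ 0F)) (sym (π-position v)) (Fin.toℕ<n v)))
                    (π-position v)))
  (length-tabulate (λ v → v))
  where
  value : Fin (toℕ (π ⟨$⟩ʳ 0F)) → Fin (ℕ.suc n)
  value v = fromℕ< (ℕ.<-trans (Fin.toℕ<n v) (Fin.toℕ<n (π ⟨$⟩ʳ 0F)))
  position : Fin (toℕ (π ⟨$⟩ʳ 0F)) → Fin (ℕ.suc n)
  position v = π ⟨$⟩ˡ value v
  π-position : ∀ v → toℕ (π ⟨$⟩ʳ position v) ≡ toℕ v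
  π-position v = trans (cong toℕ (inverseʳ π)) (Fin.toℕ-fromℕ< _)
  0<position : ∀ v → 0 < toℕ (position v)
  0<position v with position v | π-position v
  -- Position 0 holds the first entry itself, which exceeds `v`.
  ... | zero  | e = ⊥-elim (ℕ.<-irrefl (sym e) (Fin.toℕ<n v))
  ... | suc _ | _ = z<s

-- `punchIn` preserves the order, and position 0 never lies to the right of `suc i`.
row-suc : ∀ {n} {π : Permutation′ (ℕ.suc n)} {ρ} → Extends π ρ → ∀ i → row π (suc i) ≡ row ρ i
row-suc {n} {π} {ρ} ext i = begin
  length (filter π? (0F ∷ tabulate suc))
    ≡⟨ cong length (filter-reject π? {x = 0F} {xs = tabulate suc} λ { (() , _) }) ⟩
  length (filter π? (tabulate suc))
    ≡⟨ cong (length ∘ filter π?) (map-tabulate (λ j → j) suc) ⟨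
  length (filter π? (map suc (allFin n)))
    ≡⟨ length-filter-map π? suc (allFin n) ⟩
  length (filter (π? ∘ suc) (allFin n))
    ≡⟨ cong length (filter-≐ (π? ∘ suc) (λ j → isInversion? ρ (i , j))
         ( (λ { (s≤s i<j , >) → i<j , ext-cancel-< {π = π} {ρ} ext > })
         , (λ { (i<j , >) → s≤s i<j , ext-mono-< {π = π} {ρ} ext > })) (allFin n)) ⟩
  row ρ i ∎
  where
  open ≡-Reasoning
  π? = λ j → isInversion? π (suc i , j)

inv-rows : ∀ {n} (π : Permutation′ n) → inv π ≡ sum (map (row π) (allFin n))
inv-rows {n} π = length-filter-× (isInversion? π) (allFin n) (allFin n)

-- The recursion behind the Lehmer code: counted from 0, the first entry is the number of inversions
-- it takes part in, and the other inversions are those of `ρ`.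
inv-extends : ∀ {n} {π : Permutation′ (ℕ.suc n)} {ρ} → Extends π ρ →
              inv π ≡ toℕ (π ⟨$⟩ʳ 0F) + inv ρ
inv-extends {n} {π} {ρ} ext = begin
  inv π
    ≡⟨ inv-rows π ⟩
  row π 0F + sum (map (row π) (tabulate suc))
    ≡⟨ cong (λ rs → row π 0F + sum rs) (map-tabulate suc (row π)) ⟩
  row π 0F + sum (tabulate (row π ∘ suc))
    ≡⟨ cong (λ rs → row π 0F + sum rs) (map-tabulate (λ i → i) (row π ∘ suc)) ⟨
  row π 0F + sum (map (row π ∘ suc) (allFin n))
    ≡⟨ cong₂ (λ r rs → r + sum rs) (row-zero π) (map-cong (row-suc {π = π} {ρ} ext) (allFin n)) ⟩
  toℕ (π ⟨$⟩ʳ 0F) + sum (map (row ρ) (allFin n))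
    ≡⟨ cong (toℕ (π ⟨$⟩ʳ 0F) +_) (inv-rows ρ) ⟨
  toℕ (π ⟨$⟩ʳ 0F) + inv ρ ∎
  where open ≡-Reasoning

head≤inv : ∀ {n} (π : Permutation′ (ℕ.suc n)) → toℕ (π ⟨$⟩ʳ 0F) ≤ inv π
head≤inv π = subst (toℕ (π ⟨$⟩ʳ 0F) ≤_)
  (sym (inv-extends {π = π} {remove 0F π} (extends-remove π))) (ℕ.m≤m+n _ _)

-- A nonzero first entry takes at least one inversion with it while the length drops by one, so the
-- slack `c` survives its removal.
inv-bound : ∀ {n c} {π : Permutation′ (ℕ.suc n)} {ρ} → Extends π ρ → π ⟨$⟩ʳ 0F ≢ 0F →
            inv π + c ≤ ℕ.suc n → inv ρ + c ≤ n
inv-bound {c = c} {π} {ρ} ext π0≢0 inv≤ with π ⟨$⟩ʳ 0F | inv-extends {π = π} {ρ} ext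
... | zero  | _  = ⊥-elim (π0≢0 refl)
... | suc j | eq rewrite eq with inv≤
...   | s≤s le = ℕ.≤-trans (ℕ.+-monoˡ-≤ c (ℕ.m≤n+m (inv ρ) (toℕ j))) le

-- Pattern avoidance

Avoids132 : ∀ {n} → Permutation′ n → Set
Avoids132 {n} π = ∀ {a b c : Fin n} → a Fin.< b → b Fin.< c →
  π ⟨$⟩ʳ a Fin.< π ⟨$⟩ʳ c → π ⟨$⟩ʳ c Fin.< π ⟨$⟩ʳ b → ⊥

Avoids213 : ∀ {n} → Permutation′ n → Set
Avoids213 {n} π = ∀ {a b c : Fin n} → a Fin.< b → b Fin.< c →
  π ⟨$⟩ʳ b Fin.< π ⟨$⟩ʳ a → π ⟨$⟩ʳ a Fin.< π ⟨$⟩ʳ c → ⊥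

Avoids1324 : ∀ {n} → Permutation′ n → Set
Avoids1324 {n} π = ∀ {a b c d : Fin n} → a Fin.< b → b Fin.< c → c Fin.< d →
  π ⟨$⟩ʳ a Fin.< π ⟨$⟩ʳ c → π ⟨$⟩ʳ c Fin.< π ⟨$⟩ʳ b → π ⟨$⟩ʳ b Fin.< π ⟨$⟩ʳ d → ⊥

Avoids1243 : ∀ {n} → Permutation′ n → Set
Avoids1243 {n} π = ∀ {a b c d : Fin n} → a Fin.< b → b Fin.< c → c Fin.< d →
  π ⟨$⟩ʳ a Fin.< π ⟨$⟩ʳ b → π ⟨$⟩ʳ b Fin.< π ⟨$⟩ʳ d → π ⟨$⟩ʳ d Fin.< π ⟨$⟩ʳ c → ⊥

chain-mono-< : ∀ {n} (f : Fin 4 → Fin n) → f 0F Fin.< f 1F → f 1F Fin.< f 2F → f 2F Fin.< f 3F →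
               ∀ a b → a Fin.< b → f a Fin.< f b
chain-mono-< f p q r 0F 1F _ = p
chain-mono-< f p q r 0F 2F _ = ℕ.<-trans p q
chain-mono-< f p q r 0F 3F _ = ℕ.<-trans p (ℕ.<-trans q r)
chain-mono-< f p q r 1F 2F _ = q
chain-mono-< f p q r 1F 3F _ = ℕ.<-trans q r
chain-mono-< f p q r 2F 3F _ = r
chain-mono-< f p q r 0F 0F ()
chain-mono-< f p q r 1F 0F ()
chain-mono-< f p q r 1F 1F (s≤s ())
chain-mono-< f p q r 2F 0F ()
chain-mono-< f p q r 2F 1F (s≤s ())
chain-mono-< f p q r 2F 2F (s≤s (s≤s ()))
chain-mono-< f p q r 3F 0F ()
chain-mono-< f p q r 3F 1F (s≤s ())
chain-mono-< f p q r 3F 2F (s≤s (s≤s ()))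
chain-mono-< f p q r 3F 3F (s≤s (s≤s (s≤s ())))

-- `v` runs through the entries by increasing pattern value, so comparing neighbours suffices:
-- transitivity gives the other comparisons, and trichotomy the converse implication.
contains-chain : ∀ {n} (π : Permutation′ n) (q : Permutation′ 4) (is : Vec (Fin n) 4) →
  let v = λ a → π ⟨$⟩ʳ lookup is (q ⟨$⟩ˡ a) in
  lookup is 0F Fin.< lookup is 1F → lookup is 1F Fin.< lookup is 2F → lookup is 2F Fin.< lookup is 3F →
  v 0F Fin.< v 1F → v 1F Fin.< v 2F → v 2F Fin.< v 3F →
  Contains π (4 , q)
contains-chain π q is p₁ p₂ p₃ v₁ v₂ v₃ =
  is , chain-mono-< (lookup is) p₁ p₂ p₃ , λ a b → mono a b , reflecting a b
  where
  πis = λ a → π ⟨$⟩ʳ lookup is a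
  mono : ∀ a b → q ⟨$⟩ʳ a Fin.< q ⟨$⟩ʳ b → πis a Fin.< πis b
  mono a b qa<qb = subst₂ Fin._<_ (cong πis (inverseˡ q)) (cong πis (inverseˡ q))
    (chain-mono-< (λ a → πis (q ⟨$⟩ˡ a)) v₁ v₂ v₃ _ _ qa<qb)
  reflecting : ∀ a b → πis a Fin.< πis b → q ⟨$⟩ʳ a Fin.< q ⟨$⟩ʳ b
  reflecting a b lt with Fin.<-cmp (q ⟨$⟩ʳ a) (q ⟨$⟩ʳ b)
  ... | tri< qa<qb _ _ = qa<qb
  ... | tri≈ _ e _     = ⊥-elim (ℕ.<-irrefl (cong (toℕ ∘ πis) (injective q e)) lt)
  ... | tri> _ _ qb<qa = ⊥-elim (ℕ.<-asym lt (mono b a qb<qa))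

avoids-q₁₃₂₄ : ∀ {n} (π : Permutation′ n) → ¬ Contains π q₁₃₂₄ → Avoids1324 π
avoids-q₁₃₂₄ π av {a} {b} {c} {d} a<b b<c c<d p q r =
  av (contains-chain π (proj₂ q₁₃₂₄) (a ∷ b ∷ c ∷ d ∷ []) a<b b<c c<d p q r)

avoids-q₁₂₄₃ : ∀ {n} (π : Permutation′ n) → ¬ Contains π q₁₂₄₃ → Avoids1243 π
avoids-q₁₂₄₃ π av {a} {b} {c} {d} a<b b<c c<d p q r =
  av (contains-chain π (proj₂ q₁₂₄₃) (a ∷ b ∷ c ∷ d ∷ []) a<b b<c c<d p q r)

-- A 132 sits in the first three entries of 1324 and in the last three of 1243.
avoids132⇒avoids : ∀ {n} (π : Permutation′ n) → Avoids132 π → Avoids (q₁₃₂₄ ∷ q₁₂₄₃ ∷ []) π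
avoids132⇒avoids π av =
    (λ (_ , pos , val) → av (pos 0F 1F (s≤s z≤n)) (pos 1F 2F (s≤s (s≤s z≤n)))
       (proj₁ (val 0F 2F) (s≤s z≤n)) (proj₁ (val 2F 1F) (s≤s (s≤s z≤n))))
  ∷ (λ (_ , pos , val) → av (pos 1F 2F (s≤s (s≤s z≤n))) (pos 2F 3F (s≤s (s≤s (s≤s z≤n))))
       (proj₁ (val 1F 3F) (s≤s (s≤s z≤n))) (proj₁ (val 3F 2F) (s≤s (s≤s (s≤s z≤n)))))
  ∷ []

avoids132-extends⁻ : ∀ {n} {π : Permutation′ (ℕ.suc n)} {ρ} → Extends π ρ → Avoids132 π → Avoids132 ρ
avoids132-extends⁻ {π = π} {ρ} ext av a<b b<c p q = av (s≤s a<b) (s≤s b<c) (mono p) (mono q)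
  where
  mono : ∀ {i j} → ρ ⟨$⟩ʳ i Fin.< ρ ⟨$⟩ʳ j → π ⟨$⟩ʳ suc i Fin.< π ⟨$⟩ʳ suc j
  mono = ext-mono-< {π = π} {ρ} ext

avoids132-extends⁺ : ∀ {n} {π : Permutation′ (ℕ.suc n)} {ρ} → Extends π ρ → Avoids132 ρ →
  (∀ {b c} → b Fin.< c → π ⟨$⟩ʳ 0F Fin.< π ⟨$⟩ʳ suc c → π ⟨$⟩ʳ suc c Fin.< π ⟨$⟩ʳ suc b → ⊥) →
  Avoids132 π
avoids132-extends⁺ {π = π} {ρ} ext av av₀ {zero}  {suc b} {suc c} _         (s≤s b<c) p q = av₀ b<c p q
avoids132-extends⁺ {π = π} {ρ} ext av av₀ {suc a} {suc b} {suc c} (s≤s a<b) (s≤s b<c) p q =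
  av a<b b<c (ext-cancel-< {π = π} {ρ} ext p) (ext-cancel-< {π = π} {ρ} ext q)

-- Permutations with few inversions

head-minimal : ∀ {n} (π : Permutation′ (ℕ.suc n)) → π ⟨$⟩ʳ 0F ≡ 0F → ∀ i → π ⟨$⟩ʳ 0F Fin.< π ⟨$⟩ʳ suc i
head-minimal π π0≡0 i = ≤∧≢⇒< (subst (Fin._≤ π ⟨$⟩ʳ suc i) (sym π0≡0) z≤n) λ e → Fin.0≢1+n (injective π e)

-- If the first entry is minimal, an entry above the last would form a 132 with these two. Otherwise
-- the last entry is maximal among the rest by induction, and the first entry, being at most the
-- number of inversions, is too small to exceed it.
last-maximal : ∀ {n} (π : Permutation′ (ℕ.suc n)) → inv π + 2 ≤ ℕ.suc n → Avoids132 π →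
               ∀ i → π ⟨$⟩ʳ i Fin.≤ π ⟨$⟩ʳ fromℕ n
last-maximal {ℕ.zero}  π inv≤ _  _ = ⊥-elim (ℕ.<⇒≱ (ℕ.m≤n+m 2 (inv π)) inv≤)
last-maximal {ℕ.suc m} π inv≤ av i with π ⟨$⟩ʳ 0F Fin.≟ 0F
last-maximal {ℕ.suc m} π inv≤ av zero    | yes π0≡0 = ℕ.<⇒≤ (head-minimal π π0≡0 (fromℕ m))
last-maximal {ℕ.suc m} π inv≤ av (suc i) | yes π0≡0 with i Fin.≟ fromℕ m
... | yes refl  = ℕ.≤-refl
... | no  i≢last = ℕ.≮⇒≥ λ > →
  av z<s (s≤s (≤∧≢⇒< (Fin.≤fromℕ i) i≢last)) (head-minimal π π0≡0 (fromℕ m)) >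
last-maximal {ℕ.suc m} π inv≤ av i       | no  π0≢0 = go i
  where
  ρ = remove 0F π
  ext = extends-remove π
  ρ-last : ∀ j → ρ ⟨$⟩ʳ j Fin.≤ ρ ⟨$⟩ʳ fromℕ m
  ρ-last = last-maximal ρ (inv-bound {π = π} {ρ} ext π0≢0 inv≤) (avoids132-extends⁻ {π = π} {ρ} ext av)
  π0≤ρ-last : toℕ (π ⟨$⟩ʳ 0F) ≤ toℕ (ρ ⟨$⟩ʳ fromℕ m)
  π0≤ρ-last = begin
    toℕ (π ⟨$⟩ʳ 0F)                    ≤⟨ head≤inv π ⟩
    inv π                              ≤⟨ ℕ.+-cancelʳ-≤ 2 (inv π) m (subst (inv π + 2 ≤_) (ℕ.+-comm 2 m) inv≤) ⟩
    m                                  ≡⟨ Fin.toℕ-fromℕ m ⟨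
    -- The largest value `m` is taken by some entry of `ρ`, and none exceeds the last.
    toℕ (fromℕ m)                      ≡⟨ cong toℕ (inverseʳ ρ) ⟨
    toℕ (ρ ⟨$⟩ʳ (ρ ⟨$⟩ˡ fromℕ m))      ≤⟨ ρ-last _ ⟩
    toℕ (ρ ⟨$⟩ʳ fromℕ m)               ∎
    where open ℕ.≤-Reasoning
  go : ∀ i → π ⟨$⟩ʳ i Fin.≤ π ⟨$⟩ʳ fromℕ (ℕ.suc m)
  go zero    = ℕ.<⇒≤ (≤⇒head< {π = π} {ρ} ext π0≤ρ-last)
  go (suc j) = subst₂ Fin._≤_ (sym (ext j)) (sym (ext (fromℕ m)))
                 (Fin.punchIn-mono-≤ (π ⟨$⟩ʳ 0F) _ _ (ρ-last j))

-- The last entry will do: it is maximal, so it cannot be the lower end of a descent. It later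
-- provides the 4 of a 1324.
above-descent : ∀ {n} (π : Permutation′ n) → inv π + 2 ≤ n → Avoids132 π →
                ∀ {i j} → i Fin.< j → π ⟨$⟩ʳ j Fin.< π ⟨$⟩ʳ i →
                ∃ λ l → j Fin.< l × π ⟨$⟩ʳ i Fin.< π ⟨$⟩ʳ l
above-descent {ℕ.zero}  π _ _ {()}
above-descent {ℕ.suc n} π inv≤ av {i} {j} i<j πj<πi = fromℕ n ,
  ≤∧≢⇒< (Fin.≤fromℕ j) (λ { refl → ℕ.<⇒≱ πj<πi (last-maximal π inv≤ av i) }) ,
  ≤∧≢⇒< (last-maximal π inv≤ av i) (λ e → ℕ.<-irrefl (cong toℕ (injective π e)) (ℕ.≤-trans i<j (Fin.≤fromℕ j)))

-- Only an occurrence of 132 starting at the first entry is left to the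
-- induction.  The last entry completes it to 1324 unless the first entry is
-- minimal, in which case the remaining entries must be increasing.
avoids⇒avoids132 : ∀ {n} (π : Permutation′ n) → inv π + 3 ≤ n →
                   Avoids1324 π → Avoids1243 π → Avoids132 π
avoids⇒avoids132 {ℕ.zero}  π _ _ _ {()}
avoids⇒avoids132 {ℕ.suc n} π inv≤ av₁₃₂₄ av₁₂₄₃ with π ⟨$⟩ʳ 0F Fin.≟ 0F
... | yes π0≡0 = avoids132-extends⁺ {π = π} {ρ} ext ρ-avoids132
    -- A descent followed by an entry above both is a 213.
    λ b<c _ πc<πb →
      let ρc<ρb = ext-cancel-< {π = π} {ρ} ext πc<πb
          d , c<d , ρb<ρd = above-descent ρ inv-ρ≤ ρ-avoids132 b<c ρc<ρb
      in ρ-avoids213 b<c c<d ρc<ρb ρb<ρd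
  where
  ρ = remove 0F π
  ext = extends-remove π
  -- A minimal first entry takes no inversion with it, so the slack falls from 3 to 2, just what
  -- `above-descent` asks for.
  inv-ρ≤ : inv ρ + 2 ≤ n
  inv-ρ≤ = ℕ.+-cancelˡ-≤ 1 _ _ (subst (_≤ ℕ.suc n)
    (trans (cong (_+ 3) (trans (inv-extends {π = π} {ρ} ext) (cong (λ j → toℕ j + inv ρ) π0≡0)))
           (ℕ.+-suc (inv ρ) 2)) inv≤)
  mono : ∀ {i j} → ρ ⟨$⟩ʳ i Fin.< ρ ⟨$⟩ʳ j → π ⟨$⟩ʳ suc i Fin.< π ⟨$⟩ʳ suc j
  mono = ext-mono-< {π = π} {ρ} ext
  -- Prefixed by the minimal first entry, a 132 becomes a 1243 and a 213 becomes a 1324.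
  ρ-avoids132 : Avoids132 ρ
  ρ-avoids132 {a} a<b b<c v w =
    av₁₂₄₃ z<s (s≤s a<b) (s≤s b<c) (head-minimal π π0≡0 a) (mono v) (mono w)
  ρ-avoids213 : Avoids213 ρ
  ρ-avoids213 {b = b} a<b b<c v w =
    av₁₃₂₄ z<s (s≤s a<b) (s≤s b<c) (head-minimal π π0≡0 b) (mono v) (mono w)
... | no π0≢0 = avoids132-extends⁺ {π = π} {ρ} ext ρ-avoids132 first
  where
  ρ = remove 0F π
  ext = extends-remove π
  inv-ρ≤ : inv ρ + 3 ≤ n
  inv-ρ≤ = inv-bound {π = π} {ρ} ext π0≢0 inv≤
  mono : ∀ {i j} → ρ ⟨$⟩ʳ i Fin.< ρ ⟨$⟩ʳ j → π ⟨$⟩ʳ suc i Fin.< π ⟨$⟩ʳ suc j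
  mono = ext-mono-< {π = π} {ρ} ext
  ρ-avoids132 : Avoids132 ρ
  ρ-avoids132 = avoids⇒avoids132 ρ inv-ρ≤
    (λ a<b b<c c<d u v w → av₁₃₂₄ (s≤s a<b) (s≤s b<c) (s≤s c<d) (mono u) (mono v) (mono w))
    (λ a<b b<c c<d u v w → av₁₂₄₃ (s≤s a<b) (s≤s b<c) (s≤s c<d) (mono u) (mono v) (mono w))
  first : ∀ {b c} → b Fin.< c → π ⟨$⟩ʳ 0F Fin.< π ⟨$⟩ʳ suc c → π ⟨$⟩ʳ suc c Fin.< π ⟨$⟩ʳ suc b → ⊥
  first b<c π0<πc πc<πb =
    -- The slack is weakened from 3 to 2, and the entry found at `d` is the 4 of a 1324.
    let d , c<d , ρb<ρd = above-descent ρ (ℕ.≤-trans (ℕ.+-monoʳ-≤ (inv ρ) (ℕ.n≤1+n 2)) inv-ρ≤) ρ-avoids132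
                            b<c (ext-cancel-< {π = π} {ρ} ext πc<πb)
    in av₁₃₂₄ z<s (s≤s b<c) (s≤s c<d) π0<πc πc<πb (mono ρb<ρd)

-- Lehmer codes

-- Code π xs says that xs followed by zeros is the Lehmer code of π.
data Code : ∀ {n} → Permutation′ n → List ℕ → Set where
  empty : {π : Permutation′ 0} → Code π []
  zeros : ∀ {n} {π : Permutation′ (ℕ.suc n)} {ρ} →
          π ⟨$⟩ʳ 0F ≡ 0F → Extends π ρ → Code ρ [] → Code π []
  entry : ∀ {n} {π : Permutation′ (ℕ.suc n)} {ρ} {x xs} →
          toℕ (π ⟨$⟩ʳ 0F) ≡ x → Extends π ρ → Code ρ xs → Code π (x ∷ xs)

extends-resp-≈ : ∀ {n} {π π′ : Permutation′ (ℕ.suc n)} {ρ} → π ≈ π′ → Extends π ρ → Extends π′ ρ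
extends-resp-≈ {ρ = ρ} e ext i =
  trans (sym (e (suc i))) (trans (ext i) (cong (λ j → punchIn j (ρ ⟨$⟩ʳ i)) (e 0F)))

code-resp-≈ : ∀ {n} {π π′ : Permutation′ n} {xs} → π ≈ π′ → Code π xs → Code π′ xs
code-resp-≈ e empty = empty
code-resp-≈ {π = π} {π′} e (zeros {ρ = ρ} π0≡0 ext c) =
  zeros (trans (sym (e 0F)) π0≡0) (extends-resp-≈ {π = π} {π′} {ρ} e ext) c
code-resp-≈ {π = π} {π′} e (entry {ρ = ρ} π0≡x ext c) =
  entry (trans (cong toℕ (sym (e 0F))) π0≡x) (extends-resp-≈ {π = π} {π′} {ρ} e ext) c

≈-extends : ∀ {n} {π π′ : Permutation′ (ℕ.suc n)} {ρ ρ′} → Extends π ρ → Extends π′ ρ′ →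
            π ⟨$⟩ʳ 0F ≡ π′ ⟨$⟩ʳ 0F → ρ ≈ ρ′ → π ≈ π′
≈-extends ext ext′ e ρ≈ρ′ zero    = e
≈-extends ext ext′ e ρ≈ρ′ (suc i) = trans (ext i) (trans (cong₂ punchIn e (ρ≈ρ′ i)) (sym (ext′ i)))

-- The length and the list decide which constructor applies at each stage, so both permutations are
-- rebuilt from the same first entries.
code-injective : ∀ {n} {π π′ : Permutation′ n} {xs} → Code π xs → Code π′ xs → π ≈ π′
code-injective empty empty ()
code-injective {π = π} {π′} (zeros {ρ = ρ} e ext c) (zeros {ρ = ρ′} e′ ext′ c′) =
  ≈-extends {π = π} {π′} {ρ} {ρ′} ext ext′ (trans e (sym e′)) (code-injective c c′)
code-injective {π = π} {π′} (entry {ρ = ρ} e ext c) (entry {ρ = ρ′} e′ ext′ c′) =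
  ≈-extends {π = π} {π′} {ρ} {ρ′} ext ext′ (Fin.toℕ-injective (trans e (sym e′))) (code-injective c c′)

extends-functional : ∀ {n} {π : Permutation′ (ℕ.suc n)} {ρ ρ′} → Extends π ρ → Extends π ρ′ → ρ ≈ ρ′
extends-functional {π = π} ext ext′ i =
  Fin.punchIn-injective (π ⟨$⟩ʳ 0F) _ _ (trans (sym (ext i)) (ext′ i))

-- Positivity settles where the trailing zeros begin: the permutation of length 1 has both `[]` and
-- `0 ∷ []` as codes.
code-functional : ∀ {n} {π : Permutation′ n} {xs ys} → All (0 <_) xs → All (0 <_) ys →
                  Code π xs → Code π ys → xs ≡ ys
code-functional _ _ empty empty = refl
code-functional _ _ (zeros _ _ _) (zeros _ _ _) = refl
code-functional _ (0<y ∷ _) (zeros e _ _) (entry refl _ _) = ⊥-elim (ℕ.<-irrefl (cong toℕ (sym e)) 0<y)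
code-functional (0<x ∷ _) _ (entry refl _ _) (zeros e _ _) = ⊥-elim (ℕ.<-irrefl (cong toℕ (sym e)) 0<x)
code-functional {π = π} (_ ∷ 0<xs) (_ ∷ 0<ys) (entry {ρ = ρ} e ext c) (entry {ρ = ρ′} e′ ext′ c′) =
  cong₂ _∷_ (trans (sym e) e′)
    (code-functional 0<xs 0<ys c
      -- The two remainders agree only pointwise, so the second code is carried over to the first.
      (code-resp-≈ (extends-functional {π = π} {ρ′} {ρ} ext′ ext) c′))

code-sum : ∀ {n} {π : Permutation′ n} {xs} → Code π xs → inv π ≡ sum xs
code-sum empty = refl
code-sum {π = π} (zeros {ρ = ρ} π0≡0 ext c) =
  trans (inv-extends {π = π} {ρ} ext) (cong₂ _+_ (cong toℕ π0≡0) (code-sum c))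
code-sum {π = π} (entry {ρ = ρ} π0≡x ext c) =
  trans (inv-extends {π = π} {ρ} ext) (cong₂ _+_ π0≡x (code-sum c))

-- If the code increases at the start, the value one above the first occurs after
-- the second entry.
avoids132⇒heads-≥ : ∀ {n} {π : Permutation′ (ℕ.suc (ℕ.suc n))} {ρ} → Extends π ρ → Avoids132 π →
                    toℕ (ρ ⟨$⟩ʳ 0F) ≤ toℕ (π ⟨$⟩ʳ 0F)
avoids132⇒heads-≥ {n} {π} {ρ} ext av = ℕ.≮⇒≥ go
  where
  go : ¬ (toℕ (π ⟨$⟩ʳ 0F) < toℕ (ρ ⟨$⟩ʳ 0F))
  go π0<ρ0 = av z<s 0<c (≤⇒head< {π = π} {ρ} ext (ℕ.≤-reflexive (sym ρc≡π0)))
                        (ext-mono-< {π = π} {ρ} ext ρc<ρ0)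
    where
    -- The value in `ρ` equal to the first entry of `π`; prepending that entry lifts it by exactly
    -- one.
    v : Fin (ℕ.suc n)
    v = fromℕ< (ℕ.<-trans π0<ρ0 (Fin.toℕ<n (ρ ⟨$⟩ʳ 0F)))
    c = ρ ⟨$⟩ˡ v
    ρc≡π0 : toℕ (ρ ⟨$⟩ʳ c) ≡ toℕ (π ⟨$⟩ʳ 0F)
    ρc≡π0 = trans (cong toℕ (inverseʳ ρ)) (Fin.toℕ-fromℕ< _)
    ρc<ρ0 : ρ ⟨$⟩ʳ c Fin.< ρ ⟨$⟩ʳ 0F
    ρc<ρ0 = subst (_< toℕ (ρ ⟨$⟩ʳ 0F)) (sym ρc≡π0) π0<ρ0
    0<c : 1 < toℕ (suc c)
    0<c = s≤s (≤∧≢⇒< z≤n λ e → ℕ.<-irrefl (cong (λ i → toℕ (ρ ⟨$⟩ʳ i)) (sym e)) ρc<ρ0)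

-- A 132 starting at the first entry could start at the second instead: an entry above the first is
-- also above the second. If the second entry is itself the 3, this contradicts its exceeding the 2.
heads-≥⇒avoids132 : ∀ {n} {π : Permutation′ (ℕ.suc (ℕ.suc n))} {ρ} → Extends π ρ →
                    toℕ (ρ ⟨$⟩ʳ 0F) ≤ toℕ (π ⟨$⟩ʳ 0F) → Avoids132 ρ → Avoids132 π
heads-≥⇒avoids132 {π = π} {ρ} ext ρ0≤π0 av = avoids132-extends⁺ {π = π} {ρ} ext av first
  where
  first : ∀ {b c} → b Fin.< c → π ⟨$⟩ʳ 0F Fin.< π ⟨$⟩ʳ suc c → π ⟨$⟩ʳ suc c Fin.< π ⟨$⟩ʳ suc b → ⊥
  first {zero}  {suc c} _   π0<πc πc<πb = ℕ.<⇒≱ (ext-cancel-< {π = π} {ρ} ext πc<πb)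
    (ℕ.≤-trans ρ0≤π0 (head<⇒≤ {π = π} {ρ} ext π0<πc))
  first {suc b} {suc c} b<c π0<πc πc<πb = av z<s b<c
    (≤∧≢⇒< (ℕ.≤-trans ρ0≤π0 (head<⇒≤ {π = π} {ρ} ext π0<πc)) (λ e → Fin.0≢1+n (injective ρ e)))
    (ext-cancel-< {π = π} {ρ} ext πc<πb)

code-head : ∀ {n} {π : Permutation′ (ℕ.suc n)} {x xs} → Code π (x ∷ xs) → toℕ (π ⟨$⟩ʳ 0F) ≡ x
code-head (entry e _ _) = e

code-head-[] : ∀ {n} {π : Permutation′ (ℕ.suc n)} → Code π [] → toℕ (π ⟨$⟩ʳ 0F) ≡ 0
code-head-[] (zeros e _ _) = cong toℕ e

-- The code is built from its right end. It decreases weakly, so its zeros are all trailing, and a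
-- part is recorded from the first nonzero one onwards.
avoids132⇒code : ∀ {n} (π : Permutation′ n) → Avoids132 π →
                 ∃ λ xs → Code π xs × All (0 <_) xs × Linked _≥_ xs
avoids132⇒code {ℕ.zero}  π av = [] , empty , [] , []
avoids132⇒code {ℕ.suc n} π av
  with avoids132⇒code (remove 0F π) (avoids132-extends⁻ {π = π} {remove 0F π} (extends-remove π) av)
     | π ⟨$⟩ʳ 0F Fin.≟ 0F
... | [] , c , _ , _ | yes π0≡0 = [] , zeros {ρ = remove 0F π} π0≡0 (extends-remove π) c , [] , []
... | [] , c , _ , _ | no  π0≢0 = _ , entry {ρ = remove 0F π} refl (extends-remove π) c ,
    ℕ.n≢0⇒n>0 (λ e → π0≢0 (Fin.toℕ-injective e)) ∷ [] , [-]
-- The first entry is at least the positive `y`, hence positive whatever the comparison with 0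
-- returned.
... | y ∷ ys , c@(entry refl _ _) , 0<ys@(0<y ∷ _) , ys↘ | _ =
    _ , entry {ρ = remove 0F π} refl (extends-remove π) c , ℕ.<-≤-trans 0<y y≤π0 ∷ 0<ys , y≤π0 ∷ ys↘
  where y≤π0 = avoids132⇒heads-≥ {π = π} {remove 0F π} (extends-remove π) av

-- Where the list ends the code continues with 0, so each code entry is at least the next and
-- `heads-≥⇒avoids132` applies all along.
code⇒avoids132 : ∀ {n} {π : Permutation′ n} {xs} → Code π xs → Linked _≥_ xs → Avoids132 π
code⇒avoids132 empty _ {()}
code⇒avoids132 {ℕ.suc ℕ.zero} _ _ {zero} {zero} ()
code⇒avoids132 {ℕ.suc (ℕ.suc n)} {π} (zeros {ρ = ρ} π0≡0 ext c) xs↘ =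
  heads-≥⇒avoids132 {π = π} {ρ} ext (subst (_≤ toℕ (π ⟨$⟩ʳ 0F)) (sym (code-head-[] c)) z≤n)
    (code⇒avoids132 c [])
code⇒avoids132 {ℕ.suc (ℕ.suc n)} {π} (entry {ρ = ρ} refl ext c) [-] =
  heads-≥⇒avoids132 {π = π} {ρ} ext (subst (_≤ toℕ (π ⟨$⟩ʳ 0F)) (sym (code-head-[] c)) z≤n)
    (code⇒avoids132 c [])
code⇒avoids132 {ℕ.suc (ℕ.suc n)} {π} (entry {ρ = ρ} refl ext c) (x≥y ∷ xs↘) =
  heads-≥⇒avoids132 {π = π} {ρ} ext (subst (_≤ toℕ (π ⟨$⟩ʳ 0F)) (sym (code-head c)) x≥y)
    (code⇒avoids132 c xs↘)

-- The bound makes `x` an admissible first value, and it is inherited because a positive part lowers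
-- the sum by at least one while the length drops by one.
decode : ∀ n xs → All (0 <_) xs → sum xs < n → ∃ λ (π : Permutation′ n) → Code π xs
decode n       (x ∷ xs) (0<x ∷ 0<xs) (s≤s {n = m} sum≤m) =
  let ρ , c = decode m xs 0<xs (ℕ.≤-trans (ℕ.+-monoˡ-≤ (sum xs) 0<x) sum≤m)
      x<n   = s≤s (ℕ.≤-trans (ℕ.m≤m+n x (sum xs)) sum≤m)
  in insert 0F (fromℕ< x<n) ρ ,
     entry {ρ = ρ} (Fin.toℕ-fromℕ< x<n) (extends-insert (fromℕ< x<n) ρ) c
-- Only zeros remain to be filled in; length 1 is separate because the recursive call needs a
-- positive length.
decode (ℕ.suc ℕ.zero) [] [] _ =
  id , zeros {ρ = id} refl (λ ()) empty
decode (ℕ.suc (ℕ.suc n)) [] [] _ =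
  let ρ , c = decode (ℕ.suc n) [] [] z<s
  in insert 0F 0F ρ , zeros {ρ = ρ} refl (extends-insert 0F ρ) c

-- The correspondence with partitions

proposition5p5 : ∀ (k n : ℕ) → n ≥ k + 3 → av n k (q₁₃₂₄ ∷ q₁₂₄₃ ∷ []) ≡ p k
-- Positivity is part of the relation so that a permutation is related to one list only.
proposition5p5 k n n≥k+3 = length-≡ (λ π xs → Code π xs × All (0 <_) xs)
  (λ {π} {π′} π≉π′ (c , _) (c′ , _) → π≉π′ (code-injective c c′))
  (λ xs≢ys (c , 0<xs) (c′ , 0<ys) → xs≢ys (code-functional 0<xs 0<ys c c′))
  (SetoidUnique.filter⁺ (≈-setoid n) good? {xs = permutations n} (permutations-unique n))
  (partitions-unique k)
  partition-of
  permutation-of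
  where
  B = q₁₃₂₄ ∷ q₁₂₄₃ ∷ []
  good? : Decidable (λ (π : Permutation′ n) → inv π ≡ k × Avoids B π)
  good? π = inv π ℕ.≟ k ×-dec avoids? B π

  partition-of : ∀ {π} → π ∈ filter good? (permutations n) →
                 Any (λ xs → Code π xs × All (0 <_) xs) (partitions k)
  partition-of {π} π∈ with ∈-filter⁻ good? {xs = permutations n} π∈
  ... | _ , inv≡k , (av₁ ∷ av₂ ∷ []) =
    let π-avoids132 = avoids⇒avoids132 π (subst (λ i → i + 3 ≤ n) (sym inv≡k) n≥k+3)
                        (avoids-q₁₃₂₄ π av₁) (avoids-q₁₂₄₃ π av₂)
        xs , c , 0<xs , xs↘ = avoids132⇒code π π-avoids132
    in lose (partitions-complete (0<xs , xs↘ , trans (sym (code-sum c)) inv≡k)) (c , 0<xs)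

  permutation-of : ∀ {xs} → xs ∈ partitions k →
                   Any (λ π → Code π xs × All (0 <_) xs) (filter good? (permutations n))
  permutation-of {xs} xs∈ =
    let 0<xs , xs↘ , sum≡k = partitions-sound {k} xs∈
        k<n = ℕ.≤-trans (ℕ.m<m+n k z<s) n≥k+3
        ρ , code-ρ = decode n xs 0<xs (subst (_< n) (sym sum≡k) k<n)
        -- The list of permutations contains `ρ` only up to `≈`, so its code is transferred to the
        -- listed representative.
        π , π∈ , ρ≈π = find (permutations-complete ρ)
        c = code-resp-≈ ρ≈π code-ρ
    in lose (∈-filter⁺ good? π∈
               (trans (code-sum c) sum≡k , avoids132⇒avoids π (code⇒avoids132 c xs↘)))
            (c , 0<xs)
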